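{- Let $n$ be a positive integer and put $k^* = \lfloor \frac{n-4}{6} \rfloor + 1$. Then the sequence $(JL_{n,k})_{0 \le k \le \lfloor n/2 \rfloor}$ is log-concave, i.e. $JL_{n,k}^2 \ge JL_{n,k-1}JL_{n,k+1}$ for all $1 \le k < \lfloor n/2\rfloor$; it is unimodal with $k^*$ as its only mode (the unique index at which the maximum is attained), and it is strictly increasing before the mode: $JL_{n,0} < JL_{n,1} < \cdots < JL_{n,k^*}$.
   Context: For integers $n \ge 1$ and $k \ge 0$, the Jaco-Lucas numbers are $JL_{n,k} = \sum_{i=k}^{\lfloor n/2 \rfloor} \frac{n}{n-i} \binom{n-i}{i} \binom{i}{k}$ (an empty sum, i.e. when $k > \lfloor n/2\rfloor$, equals $0$). A sequence $a_0,\dots,a_m$ of positive numbers is unimodal with mode $j$ if $a_0 \le \cdots \le a_j \ge a_{j+1} \ge \cdots \ge a_m$. -}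

module Defs where

open import Data.Nat using (ℕ; zero; suc; _+_; _*_; _∸_; _≤_; _<_)
open import Data.Nat.DivMod using (_/_)
open import Data.Nat.Combinatorics using (_C_)
open import Data.List using (List; map; upTo)
open import Data.Nat.ListAction using (sum)
open import Data.Product using (_×_)

-- natural-number division, with the (never used) convention a ÷ 0 = 0
_÷_ : ℕ → ℕ → ℕ
a ÷ zero    = 0
a ÷ (suc d) = a / suc d

sumFromTo : ℕ → ℕ → (ℕ → ℕ) → ℕ
sumFromTo k m f = sum (map (λ j → f (k + j)) (upTo (suc m ∸ k)))

-- the term  n/(n-i) * C(n-i, i)  (an integer; for 0 ≤ i ≤ ⌊n/2⌋, n ≥ 1 we have n-i ≥ 1
-- and (n-i) divides n * C(n-i,i), so the division is exact)
lucasTerm : ℕ → ℕ → ℕ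
lucasTerm n i = (n * ((n ∸ i) C i)) ÷ (n ∸ i)

JL : ℕ → ℕ → ℕ
JL n k = sumFromTo k (n / 2) (λ i → lucasTerm n i * (i C k))

-- k* = ⌊(n-4)/6⌋ + 1, computed as ⌊(n+2)/6⌋ (equal for every integer n,
-- avoiding truncated subtraction when n < 4)
kstar : ℕ → ℕ
kstar n = (n + 2) / 6

Unimodal : (ℕ → ℕ) → ℕ → ℕ → Set
Unimodal a m j =
  j ≤ m × (∀ i → i < j → a i ≤ a (suc i)) × (∀ i → j ≤ i → i < m → a (suc i) ≤ a i)

module Submission where

-- Write a(k) = JL n k and n = 2k + 2 + e. The terms l(i) = n/(n-i) C(n-i,i) satisfy
-- (i+1)(n-i-1) l(i+1) = (n-2i)(n-2i-1) l(i); summing this against C(i,k) gives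
--   5(k+1)(k+2) a(k+2) + (e+2)(e+1) a(k) = (k+1)(5e+k+3) a(k+1).
-- Hence a bound on the ratio r(k+1) = a(k+2)/a(k+1) turns into a bound of the same
-- kind on r(k), and all bounds follow by descending induction from a(k) = 0 for 2k > n:
--   r(k) ≤ (n-2k)/(2(k+1)), which drives an induction for log-concavity,
--   r(k) < (n-2k+1)/(4(k+1)) for n ≤ 6k+3, where the right side is at most 1,
--   r(k) ≥ (2n-5k-1)/(7(k+1)) for n ≤ 6k+4.
-- The last bound at k+1 gives r(k) > 1 for 6k+4 ≤ n ≤ 6k+10, and log-concavity
-- carries this down to all smaller k.

open import Defs
open import Data.Nat
open import Data.Nat.Combinatorics using
  (_C_; nC1≡n; nCn≡1; nCk≡nC[n∸k]; k>n⇒nCk≡0; nCk+nC[k+1]≡[n+1]C[k+1])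
open import Data.Nat.Divisibility using (_∣_; m∣m*n; ∣m∣n⇒∣m+n)
open import Data.Nat.DivMod
open import Data.Nat.ListAction using (sum)
open import Data.Nat.Properties
open import Data.Nat.Tactic.RingSolver using (solve; solve-∀)
open import Data.List using ([]; _∷_; applyUpTo; map; upTo)
open import Data.List.Properties using (map-upTo)
open import Data.Product using (_×_; _,_; ∃-syntax)
open import Data.Sum using (inj₁; inj₂)
open import Function using (_∘_)
open import Relation.Binary.Definitions using (tri<; tri≈; tri>)
open import Relation.Binary.PropositionalEquality
open import Relation.Nullary using (yes; no; contradiction)
open ≤-Reasoning

-- Comparison of fractions, and ratio bounds passed through the recurrence.

+≡⇒≤ : ∀ {x y} r → x + r ≡ y → x ≤ y
+≡⇒≤ {x} r eq = subst (x ≤_) eq (m≤m+n x r)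

-- Transitivity of p/q ≤ d/c ≤ x/y with denominators cleared; it trades a bound produced by the
-- recurrence for a simpler one.
cross-≤ : ∀ c d x y .{{_ : NonZero c}} {p q} → c * p ≤ d * q → y * d ≤ x * c → y * p ≤ x * q
cross-≤ c d x y {p} {q} cp≤dq yd≤xc = *-cancelˡ-≤ c (begin
  c * (y * p)  ≡⟨ solve (c ∷ y ∷ p ∷ []) ⟩
  y * (c * p)  ≤⟨ *-monoʳ-≤ y cp≤dq ⟩
  y * (d * q)  ≡⟨ *-assoc y d q ⟨
  y * d * q    ≤⟨ *-monoˡ-≤ q yd≤xc ⟩
  x * c * q    ≡⟨ solve (x ∷ c ∷ q ∷ []) ⟩
  c * (x * q)  ∎)

cross-< : ∀ c d x y .{{_ : NonZero c}} {p q} → 0 < q →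
          c * p ≤ d * q → y * d < x * c → y * p < x * q
cross-< c d x y {p} {q} 0<q cp≤dq yd<xc = *-cancelˡ-< c _ _ (begin-strict
  c * (y * p)  ≡⟨ solve (c ∷ y ∷ p ∷ []) ⟩
  y * (c * p)  ≤⟨ *-monoʳ-≤ y cp≤dq ⟩
  y * (d * q)  ≡⟨ *-assoc y d q ⟨
  y * d * q    <⟨ *-monoˡ-< q {{>-nonZero 0<q}} yd<xc ⟩
  x * c * q    ≡⟨ solve (x ∷ c ∷ q ∷ []) ⟩
  c * (x * q)  ∎)

-- The recurrence for n = 2 + 2k + e; as a record, so that x₀, x₁ and x₂ are inferred from a proof.
record Rec (k e x₀ x₁ x₂ : ℕ) : Set where
  constructor mkRec
  field
    equation : 5 * ((1 + k) * (2 + k)) * x₂ + (2 + e) * (1 + e) * x₀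
               ≡ (1 + k) * (3 + 5 * e + k) * x₁

-- Given d/c as a bound on (k+2) x₂/x₁, eliminating x₂ from the recurrence leaves c(3+5e+k) - 5d as
-- the coefficient of (k+1) x₁; `w` stands for it, so that no truncated subtraction occurs.
ratio-upper : ∀ k e c d w {x₀ x₁ x₂} → Rec k e x₀ x₁ x₂ →
              w + 5 * d ≡ c * (3 + 5 * e + k) → c * (2 + k) * x₂ ≤ d * x₁ →
              (1 + k) * w * x₁ ≤ c * ((2 + e) * (1 + e)) * x₀
ratio-upper k e c d w {x₀} {x₁} {x₂} rec weq next = +-cancelˡ-≤ (5 * (1 + k) * (d * x₁)) _ _ (begin
  5 * (1 + k) * (d * x₁) + (1 + k) * w * x₁  ≡⟨ solve (k ∷ d ∷ w ∷ x₁ ∷ []) ⟩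
  (1 + k) * ((w + 5 * d) * x₁)               ≡⟨ cong (λ z → (1 + k) * (z * x₁)) weq ⟩
  (1 + k) * (c * (3 + 5 * e + k) * x₁)       ≡⟨ solve (k ∷ e ∷ c ∷ x₁ ∷ []) ⟩
  c * ((1 + k) * (3 + 5 * e + k) * x₁)       ≡⟨ cong (c *_) (Rec.equation rec) ⟨
  c * (5 * ((1 + k) * (2 + k)) * x₂ + (2 + e) * (1 + e) * x₀)
    ≡⟨ solve (k ∷ e ∷ c ∷ x₀ ∷ x₂ ∷ []) ⟩
  5 * (1 + k) * (c * (2 + k) * x₂) + c * ((2 + e) * (1 + e)) * x₀
    ≤⟨ +-monoˡ-≤ _ (*-monoʳ-≤ (5 * (1 + k)) next) ⟩
  5 * (1 + k) * (d * x₁) + c * ((2 + e) * (1 + e)) * x₀  ∎)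

-- The hypothesis is x₂/x₁ ≥ (2e-k-2)/(7(k+2)) with the possibly negative part moved across.
-- Eliminating x₂ gives the coefficient 7(3+5e+k) - 5(2e-k-2) = 31+25e+12k.
ratio-lower : ∀ k e {x₀ x₁ x₂} → Rec k e x₀ x₁ x₂ →
              2 * e * x₁ ≤ 7 * (2 + k) * x₂ + (2 + k) * x₁ →
              7 * ((2 + e) * (1 + e)) * x₀ ≤ (1 + k) * (31 + 25 * e + 12 * k) * x₁
ratio-lower k e {x₀} {x₁} {x₂} rec next =
  +-cancelˡ-≤ (5 * (1 + k) * (7 * (2 + k) * x₂ + (2 + k) * x₁)) _ _ (begin
  5 * (1 + k) * (7 * (2 + k) * x₂ + (2 + k) * x₁) + 7 * ((2 + e) * (1 + e)) * x₀
    ≡⟨ solve (k ∷ e ∷ x₀ ∷ x₁ ∷ x₂ ∷ []) ⟩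
  7 * (5 * ((1 + k) * (2 + k)) * x₂ + (2 + e) * (1 + e) * x₀) + 5 * (1 + k) * (2 + k) * x₁
    ≡⟨ cong (λ z → 7 * z + 5 * (1 + k) * (2 + k) * x₁) (Rec.equation rec) ⟩
  7 * ((1 + k) * (3 + 5 * e + k) * x₁) + 5 * (1 + k) * (2 + k) * x₁
    ≡⟨ solve (k ∷ e ∷ x₁ ∷ []) ⟩
  5 * (1 + k) * (2 * e * x₁) + (1 + k) * (31 + 25 * e + 12 * k) * x₁
    ≤⟨ +-monoˡ-≤ _ (*-monoʳ-≤ (5 * (1 + k)) next) ⟩
  5 * (1 + k) * (7 * (2 + k) * x₂ + (2 + k) * x₁) + (1 + k) * (31 + 25 * e + 12 * k) * x₁  ∎)

-- The inductive step for log-concavity.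

-- Multiplying the recurrence at k by x₂ turns the goal into the quadratic inequality `form` in x₁
-- and x₂. The recurrence at k+1, multiplied by x₁, and log-concavity at k+1 give the similar
-- `form′`; the two ratio bounds cover the difference.
logConcave-step : ∀ k e {x₀ x₁ x₂ x₃} →
  Rec k (2 + e) x₀ x₁ x₂ → Rec (1 + k) e x₁ x₂ x₃ → x₁ * x₃ ≤ x₂ * x₂ →
  2 * (2 + k) * x₂ ≤ (2 + e) * x₁ →
  (2 + k) * (6 + 5 * e + 2 * (1 + k)) * x₂ ≤ 2 * ((2 + e) * (1 + e)) * x₁ →
  x₀ * x₂ ≤ x₁ * x₁
logConcave-step k e {x₀} {p} {q} {x₃} rec rec′ next crude sharp =
  *-cancelˡ-≤ ((4 + e) * (3 + e)) (+-cancelˡ-≤ (5 * ((1 + k) * (2 + k)) * (q * q)) _ _ (begin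
    5 * ((1 + k) * (2 + k)) * (q * q) + (4 + e) * (3 + e) * (x₀ * q)
      ≡⟨ solve (k ∷ e ∷ q ∷ x₀ ∷ []) ⟩
    (5 * ((1 + k) * (2 + k)) * q + (2 + (2 + e)) * (1 + (2 + e)) * x₀) * q
      ≡⟨ cong (_* q) (Rec.equation rec) ⟩
    (1 + k) * (3 + 5 * (2 + e) + k) * p * q
      ≤⟨ form ⟩
    5 * ((1 + k) * (2 + k)) * (q * q) + (4 + e) * (3 + e) * (p * p) ∎))
  where
  form′ : (2 + k) * (4 + 5 * e + k) * (p * q) ≤
          5 * ((2 + k) * (3 + k)) * (q * q) + (2 + e) * (1 + e) * (p * p)
  form′ = begin
    (2 + k) * (4 + 5 * e + k) * (p * q)  ≡⟨ solve (k ∷ e ∷ p ∷ q ∷ []) ⟩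
    p * ((1 + (1 + k)) * (3 + 5 * e + (1 + k)) * q)  ≡⟨ cong (p *_) (Rec.equation rec′) ⟨
    p * (5 * ((1 + (1 + k)) * (2 + (1 + k))) * x₃ + (2 + e) * (1 + e) * p)
      ≡⟨ solve (k ∷ e ∷ p ∷ x₃ ∷ []) ⟩
    5 * ((2 + k) * (3 + k)) * (p * x₃) + (2 + e) * (1 + e) * (p * p)
      ≤⟨ +-monoˡ-≤ _ (*-monoʳ-≤ (5 * ((2 + k) * (3 + k))) next) ⟩
    5 * ((2 + k) * (3 + k)) * (q * q) + (2 + e) * (1 + e) * (p * p) ∎

  linear : 2 * (2 + k) * (5 * q + 9 * p) ≤ (46 + 5 * e + 18 * k) * p
  linear = begin
    2 * (2 + k) * (5 * q + 9 * p)                ≡⟨ solve (k ∷ p ∷ q ∷ []) ⟩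
    5 * (2 * (2 + k) * q) + 18 * (2 + k) * p     ≤⟨ +-monoˡ-≤ _ (*-monoʳ-≤ 5 crude) ⟩
    5 * ((2 + e) * p) + 18 * (2 + k) * p         ≡⟨ solve (k ∷ e ∷ p ∷ []) ⟩
    (46 + 5 * e + 18 * k) * p                    ∎

  -- What `form` needs beyond (k+1) times `form′`: the factor q is bounded by `sharp`, the factor
  -- 5q+9p by `linear`.
  small : (1 + k) * (2 + k) * (q * (5 * q + 9 * p)) ≤
          ((2 + e) * (1 + e) + (2 + k) * (10 + 4 * e)) * (p * p)
  small = *-cancelˡ-≤ (2 * (2 + k) * (6 + 5 * e + 2 * (1 + k))) (begin
    2 * (2 + k) * (6 + 5 * e + 2 * (1 + k)) * ((1 + k) * (2 + k) * (q * (5 * q + 9 * p)))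
      ≡⟨ solve (k ∷ e ∷ p ∷ q ∷ []) ⟩
    (1 + k) * ((2 + k) * (6 + 5 * e + 2 * (1 + k)) * q * (2 * (2 + k) * (5 * q + 9 * p)))
      ≤⟨ *-monoʳ-≤ (1 + k) (*-mono-≤ sharp linear) ⟩
    (1 + k) * (2 * ((2 + e) * (1 + e)) * p * ((46 + 5 * e + 18 * k) * p))
      -- The witness is the difference of the two sides, a polynomial with nonnegative coefficients.
      ≤⟨ +≡⇒≤ (2 * (p * p) *
           (260 + 248 * e + 65 * (e * e) + 5 * (e * e * e)
            + 296 * k + 204 * (k * e) + 28 * (k * e * e)
            + 128 * (k * k) + 66 * (k * k * e) + 4 * (k * k * e * e)
            + 20 * (k * k * k) + 8 * (k * k * k * e)))
           (solve (k ∷ e ∷ p ∷ [])) ⟩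
    2 * (2 + k) * (6 + 5 * e + 2 * (1 + k)) * (((2 + e) * (1 + e) + (2 + k) * (10 + 4 * e)) * (p * p)) ∎)

  form : (1 + k) * (3 + 5 * (2 + e) + k) * p * q ≤
         5 * ((1 + k) * (2 + k)) * (q * q) + (4 + e) * (3 + e) * (p * p)
  form = *-cancelˡ-≤ (2 + k) (begin
    (2 + k) * ((1 + k) * (3 + 5 * (2 + e) + k) * p * q)  ≡⟨ solve (k ∷ e ∷ p ∷ q ∷ []) ⟩
    (1 + k) * ((2 + k) * (4 + 5 * e + k) * (p * q)) + 9 * ((1 + k) * (2 + k)) * (p * q)
      ≤⟨ +-monoˡ-≤ _ (*-monoʳ-≤ (1 + k) form′) ⟩
    (1 + k) * (5 * ((2 + k) * (3 + k)) * (q * q) + (2 + e) * (1 + e) * (p * p))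
    + 9 * ((1 + k) * (2 + k)) * (p * q)
      ≡⟨ solve (k ∷ e ∷ p ∷ q ∷ []) ⟩
    (1 + k) * (2 + k) * (q * (5 * q + 9 * p))
    + (5 * ((1 + k) * (2 + k) * (2 + k)) * (q * q) + (1 + k) * ((2 + e) * (1 + e)) * (p * p))
      ≤⟨ +-monoˡ-≤ _ small ⟩
    ((2 + e) * (1 + e) + (2 + k) * (10 + 4 * e)) * (p * p)
    + (5 * ((1 + k) * (2 + k) * (2 + k)) * (q * q) + (1 + k) * ((2 + e) * (1 + e)) * (p * p))
      ≡⟨ solve (k ∷ e ∷ p ∷ q ∷ []) ⟩
    (2 + k) * (5 * ((1 + k) * (2 + k)) * (q * q) + (4 + e) * (3 + e) * (p * p)) ∎)

-- Polynomial inequalities behind the two bounds near the mode.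

upper-quadratic : ∀ k e → 2 ≤ e → e ≤ 1 + 4 * k → 12 + e * e ≤ 4 * e + 4 * (k * e) + 12 * k
upper-quadratic zero    (suc (suc e))          _ (s≤s ())
upper-quadratic k       (suc zero)             (s≤s ()) _
-- The general case multiplies e - 1 ≤ 4k by e+3 and then needs 15 ≤ 6e, which fails at e = 2; there
-- the hypothesis forces k ≥ 1.
upper-quadratic (suc k) 2                      _ _ = +≡⇒≤ (12 + 20 * k) (solve (k ∷ []))
upper-quadratic k       e@(suc (suc (suc e′))) _ e≤ = +-cancelˡ-≤ 3 _ _ (begin
  3 + (12 + e * e)                        ≤⟨ +≡⇒≤ (3 + 6 * e′) (solve (e′ ∷ [])) ⟩
  (3 + e) * e + 3 * e                     ≤⟨ +-monoˡ-≤ (3 * e) (*-monoʳ-≤ (3 + e) e≤) ⟩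
  (3 + e) * (1 + 4 * k) + 3 * e           ≡⟨ expand k e ⟩
  3 + (4 * e + 4 * (k * e) + 12 * k)      ∎)
  where
  expand : ∀ k e → (3 + e) * (1 + 4 * k) + 3 * e ≡ 3 + (4 * e + 4 * (k * e) + 12 * k)
  expand = solve-∀

-- The recurrence turns the bound (1+e)/(4(k+2)) on r(k+1) into 4(2+e)(1+e)/((k+1)(7+15e+4k)) on
-- r(k), to be compared with (3+e)/(4(k+1)). With k+1 cancelled this is `upper-quadratic`.
upper-inductive : ∀ k e → 2 ≤ e → e ≤ 1 + 4 * k →
  4 * (1 + k) * (4 * ((2 + e) * (1 + e))) < (3 + e) * ((1 + k) * (7 + 15 * e + 4 * k))
upper-inductive k e 2≤e e≤ = begin-strict
  4 * (1 + k) * (4 * ((2 + e) * (1 + e)))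
    ≡⟨ solve (k ∷ e ∷ []) ⟩
  (1 + k) * (20 + 48 * e + 15 * (e * e) + (12 + e * e))
    <⟨ *-monoʳ-< (1 + k) (s≤s (+-monoʳ-≤ (20 + 48 * e + 15 * (e * e)) (upper-quadratic k e 2≤e e≤))) ⟩
  (1 + k) * (21 + 48 * e + 15 * (e * e) + (4 * e + 4 * (k * e) + 12 * k))
    ≡⟨ solve (k ∷ e ∷ []) ⟩
  (3 + e) * ((1 + k) * (7 + 15 * e + 4 * k)) ∎

k≤k*k : ∀ k → k ≤ k * k
k≤k*k zero    = z≤n
k≤k*k (suc k) = m≤m*n (suc k) (suc k)

-- Since e² - ke - 12k² = (e-4k)(e+3k) ≤ 2(e+3k), it is enough that 11k ≤ 5+8e, which holds for 2k ≤
-- e. For smaller e, e² ≤ ke+2k² suffices.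
lower-quadratic : ∀ k e → e ≤ 2 + 4 * k → e * e + 5 * k ≤ 5 + 10 * e + k * e + 12 * (k * k)
lower-quadratic k e e≤ with ≤-total e (2 * k)
... | inj₁ e≤2k = begin
  e * e + 5 * k              ≤⟨ +-mono-≤ (*-monoʳ-≤ e e≤2k) (*-monoʳ-≤ 5 (k≤k*k k)) ⟩
  e * (2 * k) + 5 * (k * k)  ≡⟨ solve (k ∷ e ∷ []) ⟩
  k * e + k * e + 5 * (k * k)  ≤⟨ +-monoˡ-≤ _ (+-monoʳ-≤ (k * e) (*-monoʳ-≤ k e≤2k)) ⟩
  k * e + k * (2 * k) + 5 * (k * k)
    ≤⟨ +≡⇒≤ (5 + 10 * e + 5 * (k * k)) (solve (k ∷ e ∷ [])) ⟩
  5 + 10 * e + k * e + 12 * (k * k) ∎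
... | inj₂ 2k≤e = +-cancelˡ-≤ (3 * (k * e)) _ _ (begin
  3 * (k * e) + (e * e + 5 * k)  ≡⟨ solve (k ∷ e ∷ []) ⟩
  (3 * k + e) * e + 5 * k        ≤⟨ +-monoˡ-≤ _ (*-monoʳ-≤ (3 * k + e) e≤) ⟩
  (3 * k + e) * (2 + 4 * k) + 5 * k  ≤⟨ +≡⇒≤ (5 + 5 * k) (solve (k ∷ e ∷ [])) ⟩
  3 * (k * e) + (5 + 2 * e + k * e + 12 * (k * k)) + 8 * (2 * k)
    ≤⟨ +-monoʳ-≤ (3 * (k * e) + (5 + 2 * e + k * e + 12 * (k * k))) (*-monoʳ-≤ 8 2k≤e) ⟩
  3 * (k * e) + (5 + 2 * e + k * e + 12 * (k * k)) + 8 * e  ≡⟨ solve (k ∷ e ∷ []) ⟩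
  3 * (k * e) + (5 + 10 * e + k * e + 12 * (k * k)) ∎)

-- After multiplication by 31+25e+12k, `ratio` replaces x₁ by x₀. What remains is
-- (31+25e+12k)(3+2e-k) ≤ 49(2+e)(1+e), which expands to `lower-quadratic`.
lower-inductive : ∀ k e x₀ x₁ → e ≤ 2 + 4 * k →
  7 * ((2 + e) * (1 + e)) * x₀ ≤ (1 + k) * (31 + 25 * e + 12 * k) * x₁ →
  2 * (2 + e) * x₀ ≤ 7 * (1 + k) * x₁ + (1 + k) * x₀
lower-inductive k e x₀ x₁ e≤ ratio = *-cancelˡ-≤ (31 + 25 * e + 12 * k) (begin
  (31 + 25 * e + 12 * k) * (2 * (2 + e) * x₀)
    ≡⟨ solve (k ∷ e ∷ x₀ ∷ []) ⟩
  (124 + 162 * e + 49 * (e * e) + 24 * (k * e) + 43 * k + (e * e + 5 * k)) * x₀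
    ≤⟨ *-monoˡ-≤ x₀ (+-monoʳ-≤
          (124 + 162 * e + 49 * (e * e) + 24 * (k * e) + 43 * k) (lower-quadratic k e e≤)) ⟩
  (124 + 162 * e + 49 * (e * e) + 24 * (k * e) + 43 * k
   + (5 + 10 * e + k * e + 12 * (k * k))) * x₀
    ≡⟨ solve (k ∷ e ∷ x₀ ∷ []) ⟩
  7 * (7 * ((2 + e) * (1 + e)) * x₀) + (1 + k) * (31 + 25 * e + 12 * k) * x₀
    ≤⟨ +-monoˡ-≤ _ (*-monoʳ-≤ 7 ratio) ⟩
  7 * ((1 + k) * (31 + 25 * e + 12 * k) * x₁) + (1 + k) * (31 + 25 * e + 12 * k) * x₀
    ≡⟨ solve (k ∷ e ∷ x₀ ∷ x₁ ∷ []) ⟩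
  (31 + 25 * e + 12 * k) * (7 * (1 + k) * x₁ + (1 + k) * x₀) ∎)

-- Ratio bounds, log-concavity and monotonicity for a sequence satisfying the recurrence.

module Ratios
  (a : ℕ → ℕ) (n : ℕ)
  (rec : ∀ k e → 2 + 2 * k + e ≡ n → Rec k e (a k) (a (1 + k)) (a (2 + k)))
  (vanish : ∀ k → n < 2 * k → a k ≡ 0)
  (positive : ∀ k → 2 * k ≤ n → 0 < a k)
  where

  -- For fixed n, raising k by one lowers e by two, so structural recursion on e is the descending
  -- induction on k.
  shift : ∀ k e → 2 + 2 * k + (2 + e) ≡ n → 2 + 2 * (1 + k) + e ≡ n
  shift k e = trans (reindex k e)
    where
    reindex : ∀ k e → 2 + 2 * (1 + k) + e ≡ 2 + 2 * k + (2 + e)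
    reindex = solve-∀

  beyond : ∀ k e → e < 2 → 2 + 2 * k + e ≡ n → a (2 + k) ≡ 0
  beyond k e e<2 eq = vanish (2 + k) (begin-strict
    n              ≡⟨ eq ⟨
    2 + 2 * k + e  <⟨ +-monoʳ-< (2 + 2 * k) e<2 ⟩
    2 + 2 * k + 2  ≡⟨ solve (k ∷ []) ⟩
    2 * (2 + k)    ∎)

  positive₁ : ∀ k e → 2 + 2 * k + e ≡ n → 0 < a (1 + k)
  positive₁ k e eq = positive (1 + k) (subst (2 * (1 + k) ≤_) eq (+≡⇒≤ e (solve (k ∷ e ∷ []))))

  positive₀ : ∀ k e → 2 + 2 * k + e ≡ n → 0 < a k
  positive₀ k e eq = positive k (subst (2 * k ≤_) eq (+≡⇒≤ (2 + e) (solve (k ∷ e ∷ []))))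

  next-zero : ∀ k e {c b} → e < 2 → 2 + 2 * k + e ≡ n → c * a (2 + k) ≤ b
  next-zero k e {c} {b} e<2 eq =
    subst (_≤ b) (sym (trans (cong (c *_) (beyond k e e<2 eq)) (*-zeroʳ c))) z≤n

  mutual
    -- `sharp` is `crude` passed through the recurrence, and `crude` follows from `sharp` at the
    -- next index because 4(1+e) ≤ 8+5e+2k.
    crude : ∀ k e → 2 + 2 * k + e ≡ n → 2 * (2 + k) * a (2 + k) ≤ e * a (1 + k)
    crude k 0 eq = next-zero k 0 {2 * (2 + k)} (s≤s z≤n) eq
    crude k 1 eq = next-zero k 1 {2 * (2 + k)} (s≤s (s≤s z≤n)) eq
    crude k (suc (suc e)) eq =
      cross-≤ ((2 + k) * (6 + 5 * e + 2 * (1 + k))) (2 * ((2 + e) * (1 + e))) (2 + e) (2 * (2 + k))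
        {a (2 + k)} {a (1 + k)} (sharp (1 + k) e (shift k e eq))
        (+≡⇒≤ ((2 + k) * ((2 + e) * (4 + e + 2 * k))) (solve (k ∷ e ∷ [])))

    sharp : ∀ k e → 2 + 2 * k + e ≡ n →
            (1 + k) * (6 + 5 * e + 2 * k) * a (1 + k) ≤ 2 * ((2 + e) * (1 + e)) * a k
    sharp k e eq = ratio-upper k e 2 e (6 + 5 * e + 2 * k) (rec k e eq)
      (solve (k ∷ e ∷ [])) (crude k e eq)

  logConcave : ∀ k e → 2 + 2 * k + e ≡ n → a k * a (2 + k) ≤ a (1 + k) * a (1 + k)
  logConcave k 0 eq = next-zero k 0 {a k} (s≤s z≤n) eq
  logConcave k 1 eq = next-zero k 1 {a k} (s≤s (s≤s z≤n)) eq
  logConcave k (suc (suc e)) eq =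
    logConcave-step k e (rec k (2 + e) eq) (rec (1 + k) e eq′) (logConcave (1 + k) e eq′)
      (crude k (2 + e) eq) (sharp (1 + k) e eq′)
    where eq′ = shift k e eq

  upper-end : ∀ k e → e < 2 → 2 + 2 * k + e ≡ n →
              (1 + k) * (4 * (3 + 5 * e + k)) * a (1 + k) ≤ 4 * ((2 + e) * (1 + e)) * a k
  upper-end k e e<2 eq = ratio-upper k e 4 0 (4 * (3 + 5 * e + k)) (rec k e eq)
    (+-identityʳ (4 * (3 + 5 * e + k))) (next-zero k e {4 * (2 + k)} e<2 eq)

  upper : ∀ k e → 2 + 2 * k + e ≡ n → e ≤ 1 + 4 * k → 4 * (1 + k) * a (1 + k) < (3 + e) * a k
  -- The constants 8 here and 24 below are 4(2+e)(1+e) at e = 0 and e = 1, where a(k+2) = 0.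
  upper k 0 eq _ = cross-< ((1 + k) * (4 * (3 + k))) 8 3 (4 * (1 + k)) {a (1 + k)} {a k} (positive₀ k 0 eq)
    (upper-end k 0 (s≤s z≤n) eq)
    (+≡⇒≤ (3 + 16 * k + 12 * (k * k)) (solve (k ∷ [])))
  upper k 1 eq _ = cross-< ((1 + k) * (4 * (8 + k))) 24 4 (4 * (1 + k)) {a (1 + k)} {a k} (positive₀ k 1 eq)
    (upper-end k 1 (s≤s (s≤s z≤n)) eq)
    (+≡⇒≤ (31 + 48 * k + 16 * (k * k)) (solve (k ∷ [])))
  upper k e@(suc (suc e′)) eq e≤ =
    cross-< ((1 + k) * (7 + 15 * e + 4 * k)) (4 * ((2 + e) * (1 + e))) (3 + e) (4 * (1 + k)) {a (1 + k)} {a k}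
      (positive₀ k e eq)
      (ratio-upper k e 4 (1 + e) (7 + 15 * e + 4 * k) (rec k e eq) (weight k e)
        (<⇒≤ (upper (1 + k) e′ (shift k e′ eq) e′≤)))
      (upper-inductive k e (s≤s (s≤s z≤n)) e≤)
    where
    weight : ∀ k e → 7 + 15 * e + 4 * k + 5 * (1 + e) ≡ 4 * (3 + 5 * e + k)
    weight = solve-∀

    e′≤ : e′ ≤ 1 + 4 * (1 + k)
    e′≤ = begin
      e′               ≤⟨ m≤n+m e′ 2 ⟩
      2 + e′           ≤⟨ e≤ ⟩
      1 + 4 * k        ≤⟨ +≡⇒≤ 4 (solve (k ∷ [])) ⟩
      1 + 4 * (1 + k)  ∎

  -- The lower bound taken at k+1, hence for n ≤ 6k+10. In the base cases e ≤ 1 the bound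
  -- (2e-k-2)/(7(k+2)) is not positive.
  lower-next : ∀ k e → 2 + 2 * k + e ≡ n → e ≤ 8 + 4 * k →
    2 * e * a (1 + k) ≤ 7 * (2 + k) * a (2 + k) + (2 + k) * a (1 + k)
  lower-next k 0 eq _ = z≤n
  lower-next k 1 eq _ = begin
    2 * a (1 + k)  ≤⟨ *-monoˡ-≤ (a (1 + k)) (m≤m+n 2 k) ⟩
    (2 + k) * a (1 + k)  ≤⟨ m≤n+m _ (7 * (2 + k) * a (2 + k)) ⟩
    7 * (2 + k) * a (2 + k) + (2 + k) * a (1 + k) ∎
  lower-next k (suc (suc e)) eq e≤ =
    lower-inductive (1 + k) e (a (1 + k)) (a (2 + k)) e≤′
      (ratio-lower (1 + k) e (rec (1 + k) e eq′) (lower-next (1 + k) e eq′ (≤-trans e≤′ e≤″)))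
    where
    eq′ = shift k e eq

    e≤′ : e ≤ 2 + 4 * (1 + k)
    e≤′ = ≤-trans (≤-pred (≤-pred e≤)) (≤-reflexive (solve (k ∷ [])))

    e≤″ : 2 + 4 * (1 + k) ≤ 8 + 4 * (1 + k)
    e≤″ = m≤n+m _ 6

  -- Here n = 6k+4+g, and g ≤ 6 is the range of `lower-next`. At g = 0 the coefficients compared are
  -- (k+1)(81+112k) and (k+1)(84+112k), so the bound just reaches the threshold.
  rise-critical : ∀ k g → g ≤ 6 → 2 + 2 * k + (2 + 4 * k + g) ≡ n → a k < a (1 + k)
  rise-critical k g g≤6 eq = subst₂ _<_ (*-identityˡ (a k)) (*-identityˡ (a (1 + k)))
    (cross-< (7 * ((2 + (2 + 4 * k + g)) * (1 + (2 + 4 * k + g))))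
      ((1 + k) * (31 + 25 * (2 + 4 * k + g) + 12 * k)) 1 1 {a k} {a (1 + k)}
      (positive₁ k (2 + 4 * k + g) eq)
      (ratio-lower k (2 + 4 * k + g) {a k} {a (1 + k)} {a (2 + k)} (rec k (2 + 4 * k + g) eq)
        (lower-next k (2 + 4 * k + g) eq bound))
      (+≡⇒≤ (2 + 24 * g + 7 * (g * g) + 3 * k + 31 * (k * g)) (solve (k ∷ g ∷ []))))
    where
    bound : 2 + 4 * k + g ≤ 8 + 4 * k
    bound = begin
      2 + 4 * k + g  ≤⟨ +-monoʳ-≤ (2 + 4 * k) g≤6 ⟩
      2 + 4 * k + 6  ≡⟨ solve (k ∷ []) ⟩
      8 + 4 * k      ∎

  -- If a(k+1) ≤ a(k), log-concavity would give a(k+1) a(k+2) ≤ a(k+1)².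
  rise-back : ∀ k e → 2 + 2 * k + e ≡ n → a (1 + k) < a (2 + k) → a k < a (1 + k)
  rise-back k e eq up = ≰⇒> λ a₁≤a₀ → <⇒≱
    (*-monoʳ-< (a (1 + k)) {{>-nonZero (positive₁ k e eq)}} up)
    (≤-trans (*-monoˡ-≤ (a (2 + k)) a₁≤a₀) (logConcave k e eq))

  rise : ∀ k e → 2 + 4 * k ≤ e → 2 + 2 * k + e ≡ n → a k < a (1 + k)
  rise k (suc zero) (s≤s ()) _
  rise k e@(suc (suc e′)) low eq with e ≤? 8 + 4 * k
  ... | yes e≤ = rise-critical k (e ∸ (2 + 4 * k)) (begin
          e ∸ (2 + 4 * k)         ≤⟨ ∸-monoˡ-≤ (2 + 4 * k) e≤ ⟩
          8 + 4 * k ∸ (2 + 4 * k) ≡⟨ m+n∸n≡m 6 (4 * k) ⟩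
          6                       ∎)
          (trans (cong (2 + 2 * k +_) (m+[n∸m]≡n low)) eq)
  -- Now n ≥ 6k+11, so the hypothesis n ≥ 6(k+1)+4 holds at k+1: the windows treated by
  -- `rise-critical` for successive k overlap.
  ... | no e≰ = rise-back k e eq (rise (1 + k) e′ (begin
          2 + 4 * (1 + k)  ≡⟨ solve (k ∷ []) ⟩
          6 + 4 * k        ≤⟨ m≤n+m _ 1 ⟩
          7 + 4 * k        ≤⟨ ≤-pred (≤-pred (≰⇒> e≰)) ⟩
          e′ ∎) (shift k e′ eq))

  fall : ∀ k e → e ≤ 1 + 4 * k → 2 + 2 * k + e ≡ n → a (1 + k) < a k
  fall k e e≤ eq = *-cancelˡ-< (4 * (1 + k)) _ _ (begin-strict
    4 * (1 + k) * a (1 + k)  <⟨ upper k e eq e≤ ⟩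
    (3 + e) * a k            ≤⟨ *-monoˡ-≤ (a k) (+-monoʳ-≤ 3 e≤) ⟩
    (4 + 4 * k) * a k        ≡⟨ cong (_* a k) (*-suc 4 k) ⟨
    4 * (1 + k) * a k ∎)

-- Binomial identities.

nC0≡1 : ∀ n → n C 0 ≡ 1
nC0≡1 n = trans (nCk≡nC[n∸k] {0} {n} z≤n) (nCn≡1 n)

-- The absorption identity, from Pascal's rule applied once to each side.
C-absorb : ∀ n k → (1 + k) * ((1 + n) C (1 + k)) ≡ (1 + n) * (n C k)
C-absorb zero    zero    = refl
C-absorb zero    (suc k) = begin-equality
  (2 + k) * (1 C (2 + k))  ≡⟨ cong ((2 + k) *_) (k>n⇒nCk≡0 {1} {2 + k} (s≤s (s≤s z≤n))) ⟩
  (2 + k) * 0              ≡⟨ *-zeroʳ (2 + k) ⟩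
  0                        ∎
C-absorb (suc n) zero    = begin-equality
  1 * ((2 + n) C 1)        ≡⟨ *-identityˡ _ ⟩
  (2 + n) C 1              ≡⟨ nC1≡n (2 + n) ⟩
  2 + n                    ≡⟨ *-identityʳ (2 + n) ⟨
  (2 + n) * 1              ≡⟨ cong ((2 + n) *_) (nC0≡1 (1 + n)) ⟨
  (2 + n) * ((1 + n) C 0)  ∎
C-absorb (suc n) (suc k) = begin-equality
  (2 + k) * ((2 + n) C (2 + k))  ≡⟨ cong ((2 + k) *_) (nCk+nC[k+1]≡[n+1]C[k+1] (1 + n) (1 + k)) ⟨
  (2 + k) * (x + y)              ≡⟨ split k x y ⟩
  (1 + k) * x + x + (2 + k) * y
    ≡⟨ cong₂ (λ u v → u + x + v) (C-absorb n k) (C-absorb n (suc k)) ⟩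
  (1 + n) * (n C k) + x + (1 + n) * (n C (1 + k))   ≡⟨ collect n x (n C k) (n C (1 + k)) ⟩
  (1 + n) * (n C k + n C (1 + k)) + x   ≡⟨ cong (λ u → (1 + n) * u + x) (nCk+nC[k+1]≡[n+1]C[k+1] n k) ⟩
  (1 + n) * x + x                ≡⟨ +-comm ((1 + n) * x) x ⟩
  (2 + n) * x                    ∎
  where
  x = (1 + n) C (1 + k)
  y = (1 + n) C (2 + k)
  split : ∀ k x y → (2 + k) * (x + y) ≡ (1 + k) * x + x + (2 + k) * y
  split = solve-∀
  collect : ∀ n x u v → (1 + n) * u + x + (1 + n) * v ≡ (1 + n) * (u + v) + x
  collect = solve-∀

-- Pascal's rule splits the left side of absorption. The upper index is k + j so that the factor n -
-- k is a variable.
C-step : ∀ k j → (1 + k) * ((k + j) C (1 + k)) ≡ j * ((k + j) C k)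
C-step k j = +-cancelˡ-≡ ((1 + k) * x) _ _ (begin-equality
  (1 + k) * x + (1 + k) * ((k + j) C (1 + k))  ≡⟨ *-distribˡ-+ (1 + k) x _ ⟨
  (1 + k) * (x + (k + j) C (1 + k))   ≡⟨ cong ((1 + k) *_) (nCk+nC[k+1]≡[n+1]C[k+1] (k + j) k) ⟩
  (1 + k) * ((1 + (k + j)) C (1 + k))        ≡⟨ C-absorb (k + j) k ⟩
  (1 + (k + j)) * x                          ≡⟨ *-distribʳ-+ x (1 + k) j ⟩
  (1 + k) * x + j * x ∎)
  where x = (k + j) C k

-- The terms l(i): exact division and first-order recurrence.

lucasTerm-exact : ∀ i m → (1 + m) * lucasTerm (i + (1 + m)) i ≡ (i + (1 + m)) * ((1 + m) C i)
lucasTerm-exact i m rewrite m+n∸m≡n i (1 + m) = m*[n/m]≡n (divisible i m)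
  where
  divisible : ∀ i m → 1 + m ∣ (i + (1 + m)) * ((1 + m) C i)
  divisible zero    m = m∣m*n _
  -- Absorption turns (i+1) C(m+1, i+1) into (m+1) C(m, i), so both summands are multiples of m+1.
  divisible (suc i) m = subst (1 + m ∣_) (sym (trans (*-distribʳ-+ ((1 + m) C (1 + i)) (1 + i) (1 + m))
    (cong (_+ (1 + m) * ((1 + m) C (1 + i))) (C-absorb m i))))
    (∣m∣n⇒∣m+n (m∣m*n (m C i)) (m∣m*n ((1 + m) C (1 + i))))

lucasTerm-beyond : ∀ n i → n < 2 * i → lucasTerm n i ≡ 0
lucasTerm-beyond n i n<2i with n ∸ i in eq
-- For n ≤ i the divisor is zero and `÷` returns its default value 0.
... | zero  = refl
... | suc m = begin-equality
  n * (suc m C i) / suc m  ≡⟨ cong (λ x → n * x / suc m) (k>n⇒nCk≡0 small) ⟩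
  n * 0 / suc m            ≡⟨ cong (_/ suc m) (*-zeroʳ n) ⟩
  0 / suc m                ≡⟨ 0/n≡0 (suc m) ⟩
  0                        ∎
  where
  small : suc m < i
  small = +-cancelˡ-< i _ _ (begin-strict
    i + suc m   ≡⟨ cong (i +_) eq ⟨
    i + (n ∸ i) ≡⟨ m+[n∸m]≡n (<⇒≤ (m∸n≢0⇒n<m {n} {i} (λ z → 0≢1+n (trans (sym z) eq)))) ⟩
    n           <⟨ n<2i ⟩
    2 * i       ≡⟨ cong (i +_) (+-identityʳ i) ⟩
    i + i ∎)

-- With the extra factor n-i = 2+i+d both quotients are cleared by `lucasTerm-exact`; then C(n-i-1,
-- i+1) is carried to C(n-i, i) by `C-step`, `C-absorb` and `C-step` again.
lucasTerm-rec : ∀ i d {n} → 2 + 2 * i + d ≡ n →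
  (1 + i) * (1 + i + d) * lucasTerm n (1 + i) ≡ (2 + d) * (1 + d) * lucasTerm n i
lucasTerm-rec i d {n} eq = *-cancelˡ-≡ _ _ (2 + i + d) (begin-equality
  (2 + i + d) * ((1 + i) * (1 + i + d) * lucasTerm n (1 + i)) ≡⟨ pull₁ i d (lucasTerm n (1 + i)) ⟩
  (1 + i) * (2 + i + d) * ((1 + i + d) * lucasTerm n (1 + i)) ≡⟨ cong ((1 + i) * (2 + i + d) *_) exact₁ ⟩
  (1 + i) * (2 + i + d) * (n * ((1 + i + d) C (1 + i))) ≡⟨ pull₂ i d n ((1 + i + d) C (1 + i)) ⟩
  n * (2 + i + d) * ((1 + i) * ((1 + i + d) C (1 + i))) ≡⟨ cong (n * (2 + i + d) *_) up ⟩
  n * (2 + i + d) * ((1 + d) * ((1 + i + d) C i)) ≡⟨ pull₃ i d n ((1 + i + d) C i) ⟩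
  n * (1 + d) * ((2 + i + d) * ((1 + i + d) C i)) ≡⟨ cong (n * (1 + d) *_) (C-absorb (1 + i + d) i) ⟨
  n * (1 + d) * ((1 + i) * ((2 + i + d) C (1 + i))) ≡⟨ cong (n * (1 + d) *_) up′ ⟩
  n * (1 + d) * ((2 + d) * ((2 + i + d) C i)) ≡⟨ pull₄ d n ((2 + i + d) C i) ⟩
  (2 + d) * (1 + d) * (n * ((2 + i + d) C i)) ≡⟨ cong ((2 + d) * (1 + d) *_) exact₀ ⟨
  (2 + d) * (1 + d) * ((2 + i + d) * lucasTerm n i) ≡⟨ pull₅ i d (lucasTerm n i) ⟩
  (2 + i + d) * ((2 + d) * (1 + d) * lucasTerm n i) ∎)
  where
  up : (1 + i) * ((1 + i + d) C (1 + i)) ≡ (1 + d) * ((1 + i + d) C i)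
  up = subst (λ m → (1 + i) * (m C (1 + i)) ≡ (1 + d) * (m C i)) (+-suc i d) (C-step i (1 + d))
  up′ : (1 + i) * ((2 + i + d) C (1 + i)) ≡ (2 + d) * ((2 + i + d) C i)
  up′ = subst (λ m → (1 + i) * (m C (1 + i)) ≡ (2 + d) * (m C i))
    (trans (+-suc i (1 + d)) (cong suc (+-suc i d))) (C-step i (2 + d))
  split₁ : ∀ i d → 1 + i + (1 + (i + d)) ≡ 2 + 2 * i + d
  split₁ = solve-∀
  split₀ : ∀ i d → i + (1 + (1 + i + d)) ≡ 2 + 2 * i + d
  split₀ = solve-∀
  exact₁ : (1 + i + d) * lucasTerm n (1 + i) ≡ n * ((1 + i + d) C (1 + i))
  exact₁ = subst (λ m → (1 + i + d) * lucasTerm m (1 + i) ≡ m * ((1 + i + d) C (1 + i)))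
    (trans (split₁ i d) eq) (lucasTerm-exact (1 + i) (i + d))
  exact₀ : (2 + i + d) * lucasTerm n i ≡ n * ((2 + i + d) C i)
  exact₀ = subst (λ m → (2 + i + d) * lucasTerm m i ≡ m * ((2 + i + d) C i))
    (trans (split₀ i d) eq) (lucasTerm-exact i (1 + i + d))
  pull₁ : ∀ i d x → (2 + i + d) * ((1 + i) * (1 + i + d) * x)
                    ≡ (1 + i) * (2 + i + d) * ((1 + i + d) * x)
  pull₁ = solve-∀
  pull₂ : ∀ i d n x → (1 + i) * (2 + i + d) * (n * x) ≡ n * (2 + i + d) * ((1 + i) * x)
  pull₂ = solve-∀
  pull₃ : ∀ i d n x → n * (2 + i + d) * ((1 + d) * x) ≡ n * (1 + d) * ((2 + i + d) * x)
  pull₃ = solve-∀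
  pull₄ : ∀ d n x → n * (1 + d) * ((2 + d) * x) ≡ (2 + d) * (1 + d) * (n * x)
  pull₄ = solve-∀
  pull₅ : ∀ i d x → (2 + d) * (1 + d) * ((2 + i + d) * x) ≡ (2 + i + d) * ((2 + d) * (1 + d) * x)
  pull₅ = solve-∀

-- Finite sums.

∑ : (ℕ → ℕ) → ℕ → ℕ
∑ f n = sum (applyUpTo f n)

∑-cong : ∀ {f g} → (∀ i → f i ≡ g i) → ∀ n → ∑ f n ≡ ∑ g n
∑-cong f≗g zero    = refl
∑-cong f≗g (suc n) = cong₂ _+_ (f≗g 0) (∑-cong (f≗g ∘ suc) n)

∑-+ : ∀ f g n → ∑ (λ i → f i + g i) n ≡ ∑ f n + ∑ g n
∑-+ f g zero    = refl
∑-+ f g (suc n) = trans (cong (f 0 + g 0 +_) (∑-+ (f ∘ suc) (g ∘ suc) n))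
  (interchange (f 0) (g 0) (∑ (f ∘ suc) n) (∑ (g ∘ suc) n))
  where
  interchange : ∀ a b c d → a + b + (c + d) ≡ a + c + (b + d)
  interchange = solve-∀

∑-* : ∀ c f n → ∑ (λ i → c * f i) n ≡ c * ∑ f n
∑-* c f zero    = sym (*-zeroʳ c)
∑-* c f (suc n) = trans (cong (c * f 0 +_) (∑-* c (f ∘ suc) n)) (sym (*-distribˡ-+ c (f 0) _))

∑-last-zero : ∀ f n → f n ≡ 0 → ∑ f (suc n) ≡ ∑ f n
∑-last-zero f zero    fn≡0 = trans (+-identityʳ (f 0)) fn≡0
∑-last-zero f (suc n) fn≡0 = cong (f 0 +_) (∑-last-zero (f ∘ suc) n fn≡0)

∑-drop : ∀ k f n → (∀ i → i < k → f i ≡ 0) → ∑ f n ≡ ∑ (λ j → f (k + j)) (n ∸ k)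
∑-drop zero    f n       _  = refl
∑-drop (suc k) f zero    _  = refl
∑-drop (suc k) f (suc n) f0 =
  trans (cong (_+ ∑ (f ∘ suc) n) (f0 0 (s≤s z≤n))) (∑-drop k (f ∘ suc) n (λ i i<k → f0 (suc i) (s≤s i<k)))

term≤∑ : ∀ f {i n} → i < n → f i ≤ ∑ f n
term≤∑ f {zero}  {suc n} _         = m≤m+n (f 0) (∑ (f ∘ suc) n)
term≤∑ f {suc i} {suc n} (s≤s i<n) = m≤n⇒m≤o+n (f 0) (term≤∑ (f ∘ suc) i<n)

*≤⇒≤/ : ∀ c k .{{_ : NonZero c}} {n} → c * k ≤ n → k ≤ n / c
*≤⇒≤/ c k {n} ck≤n = begin
  k          ≡⟨ m*n/n≡m k c ⟨
  k * c / c  ≡⟨ cong (_/ c) (*-comm k c) ⟩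
  c * k / c  ≤⟨ /-monoˡ-≤ c ck≤n ⟩
  n / c      ∎

-- Since C(i, k) = 0 for i < k, the sum may start at 0; the sums for k, k+1 and k+2 then share one
-- range.
JL≡∑ : ∀ n k → JL n k ≡ ∑ (λ i → lucasTerm n i * (i C k)) (suc (n / 2))
JL≡∑ n k = trans (cong sum (map-upTo (λ j → lucasTerm n (k + j) * ((k + j) C k)) (suc (n / 2) ∸ k)))
  (sym (∑-drop k _ (suc (n / 2)) (λ i i<k →
    trans (cong (lucasTerm n i *_) (k>n⇒nCk≡0 i<k)) (*-zeroʳ (lucasTerm n i)))))

n<2*suc[n/2] : ∀ n → n < 2 * suc (n / 2)
n<2*suc[n/2] n = begin-strict
  n                   ≡⟨ m≡m%n+[m/n]*n n 2 ⟩
  n % 2 + n / 2 * 2   <⟨ +-monoˡ-< _ (m%n<n n 2) ⟩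
  2 + n / 2 * 2       ≡⟨ *-comm (suc (n / 2)) 2 ⟩
  2 * suc (n / 2)     ∎

-- The recurrence for the Jaco-Lucas numbers, by telescoping.

module _ (n k : ℕ) where

  private
    L = lucasTerm n

    -- A telescoping certificate as in Zeilberger's method: absorption and `lucasTerm-rec` make its
    -- value at i+1 a multiple of l(i) C(i, k).
    shifted : ℕ → ℕ
    shifted i = (1 + k) * (n ∸ i) * (L i * (i C (1 + k)))

    L-beyond : ∀ i x → n < 2 * i → L i * x ≡ 0
    L-beyond i x n<2i = cong (_* x) (lucasTerm-beyond n i n<2i)

    shifted-beyond : ∀ i → n < 2 * i → shifted i ≡ 0
    shifted-beyond i n<2i = trans
      (cong ((1 + k) * (n ∸ i) *_) (L-beyond i (i C (1 + k)) n<2i)) (*-zeroʳ ((1 + k) * (n ∸ i)))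

    -- shifted (suc i) = d (d - 1) L i (i C k), with the subtraction moved across.
    shifted-suc : ∀ i d → 2 * i + d ≡ n →
      shifted (suc i) + d * (L i * (i C k)) ≡ d * d * (L i * (i C k))
    -- For d ≤ 1 the index i+1 lies beyond n/2, so the shifted term vanishes, as does d(d-1).
    shifted-suc i 0 eq = trans (+-identityʳ _) (shifted-beyond (suc i)
      (subst (_< 2 * suc i) eq (+≡⇒≤ 1 (solve (i ∷ [])))))
    shifted-suc i 1 eq = cong (_+ 1 * (L i * (i C k))) (shifted-beyond (suc i)
      (subst (_< 2 * suc i) eq (+≡⇒≤ 0 (solve (i ∷ [])))))
    shifted-suc i (suc (suc d)) eq = begin-equality
      (1 + k) * (n ∸ suc i) * (L (suc i) * (suc i C suc k)) + (2 + d) * z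
        ≡⟨ cong (λ m → (1 + k) * m * (L (suc i) * (suc i C suc k)) + (2 + d) * z) n∸suc-i ⟩
      (1 + k) * (1 + i + d) * (L (suc i) * (suc i C suc k)) + (2 + d) * z
        ≡⟨ cong (_+ (2 + d) * z) (swap₁ k i d (L (suc i)) (suc i C suc k)) ⟩
      (1 + i + d) * L (suc i) * ((1 + k) * (suc i C suc k)) + (2 + d) * z
        ≡⟨ cong (λ u → (1 + i + d) * L (suc i) * u + (2 + d) * z) (C-absorb i k) ⟩
      (1 + i + d) * L (suc i) * ((1 + i) * (i C k)) + (2 + d) * z
        ≡⟨ cong (_+ (2 + d) * z) (swap₂ i d (L (suc i)) (i C k)) ⟩
      (1 + i) * (1 + i + d) * L (suc i) * (i C k) + (2 + d) * z
        ≡⟨ cong (λ u → u * (i C k) + (2 + d) * z) (lucasTerm-rec i d eq′) ⟩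
      (2 + d) * (1 + d) * L i * (i C k) + (2 + d) * z
        ≡⟨ swap₃ d (L i) (i C k) ⟩
      (2 + d) * (2 + d) * z ∎
      where
      z = L i * (i C k)
      reindex : ∀ i d → 2 + 2 * i + d ≡ 2 * i + (2 + d)
      reindex = solve-∀
      eq′ : 2 + 2 * i + d ≡ n
      eq′ = trans (reindex i d) eq
      peel : ∀ i d → suc i + (1 + i + d) ≡ 2 * i + (2 + d)
      peel = solve-∀
      n∸suc-i : n ∸ suc i ≡ 1 + i + d
      n∸suc-i = trans (cong (_∸ suc i) (sym (trans (peel i d) eq))) (m+n∸m≡n (suc i) (1 + i + d))
      swap₁ : ∀ k i d x y → (1 + k) * (1 + i + d) * (x * y) ≡ (1 + i + d) * x * ((1 + k) * y)
      swap₁ = solve-∀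
      swap₂ : ∀ i d x y → (1 + i + d) * x * ((1 + i) * y) ≡ (1 + i) * (1 + i + d) * x * y
      swap₂ = solve-∀
      swap₃ : ∀ d x y → (2 + d) * (1 + d) * x * y + (2 + d) * (x * y) ≡ (2 + d) * (2 + d) * (x * y)
      swap₃ = solve-∀

    -- The recurrence before summation over i: the terms in shifted telescope.
    Pointwise : ℕ → ℕ → Set
    Pointwise e i =
      5 * ((1 + k) * (2 + k)) * (L i * (i C (2 + k))) + (2 + e) * (1 + e) * (L i * (i C k))
      + shifted i
        ≡ (1 + k) * (3 + 5 * e + k) * (L i * (i C (1 + k))) + shifted (suc i)

    pointwise-zero : ∀ e i → L i * (i C (2 + k)) ≡ 0 → L i * (i C (1 + k)) ≡ 0 → L i * (i C k) ≡ 0 →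
                     shifted (suc i) ≡ 0 → Pointwise e i
    pointwise-zero e i p q r s rewrite p | q | r | s =
      zeros (5 * ((1 + k) * (2 + k))) ((2 + e) * (1 + e)) ((1 + k) * (n ∸ i)) ((1 + k) * (3 + 5 * e + k))
      where
      zeros : ∀ a b c d → a * 0 + b * 0 + c * 0 ≡ d * 0 + 0
      zeros = solve-∀

    pointwise-above : ∀ e i → n < 2 * i → Pointwise e i
    pointwise-above e i n<2i = pointwise-zero e i (L-beyond i _ n<2i) (L-beyond i _ n<2i) (L-beyond i _ n<2i)
      (shifted-beyond (suc i) (≤-trans n<2i (*-monoʳ-≤ 2 (n≤1+n i))))

    *C-zero : ∀ c {i m} → i < m → c * (i C m) ≡ 0
    *C-zero c i<m = trans (cong (c *_) (k>n⇒nCk≡0 i<m)) (*-zeroʳ c)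

    pointwise-below : ∀ e i → i < k → Pointwise e i
    pointwise-below e i i<k = pointwise-zero e i (*C-zero (L i) (m<n⇒m<1+n (m<n⇒m<1+n i<k)))
      (*C-zero (L i) (m<n⇒m<1+n i<k)) (*C-zero (L i) i<k)
      (trans (cong ((1 + k) * (n ∸ suc i) *_) (*C-zero (L (suc i)) (s≤s i<k)))
        (*-zeroʳ ((1 + k) * (n ∸ suc i))))

    -- Only C(k, k) survives, and both sides equal (e+2)(e+1) l(k). Adding (2+e) z brings them to
    -- the subtraction-free form of `shifted-suc`.
    pointwise-at : ∀ e → 2 + 2 * k + e ≡ n → Pointwise e k
    pointwise-at e eq = +-cancelʳ-≡ ((2 + e) * z) _ _ (begin-equality
      a * (L k * (k C (2 + k))) + b * z + c * (L k * (k C (1 + k))) + (2 + e) * z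
        ≡⟨ cong₂ (λ u v → a * u + b * z + c * v + (2 + e) * z)
             (*C-zero (L k) (s≤s (n≤1+n k))) (*C-zero (L k) (n<1+n k)) ⟩
      a * 0 + b * z + c * 0 + (2 + e) * z
        ≡⟨ square a c e z ⟩
      (2 + e) * (2 + e) * z
        ≡⟨ shifted-suc k (2 + e) (trans (reindex k e) eq) ⟨
      shifted (suc k) + (2 + e) * z
        ≡⟨ cong (λ u → u + shifted (suc k) + (2 + e) * z) (sym (*-zeroʳ f)) ⟩
      f * 0 + shifted (suc k) + (2 + e) * z
        ≡⟨ cong (λ u → f * u + shifted (suc k) + (2 + e) * z) (*C-zero (L k) (n<1+n k)) ⟨
      f * (L k * (k C (1 + k))) + shifted (suc k) + (2 + e) * z ∎)
      where
      z = L k * (k C k)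
      a = 5 * ((1 + k) * (2 + k))
      b = (2 + e) * (1 + e)
      c = (1 + k) * (n ∸ k)
      f = (1 + k) * (3 + 5 * e + k)
      square : ∀ a c e z → a * 0 + (2 + e) * (1 + e) * z + c * 0 + (2 + e) * z ≡ (2 + e) * (2 + e) * z
      square = solve-∀
      reindex : ∀ k e → 2 * k + (2 + e) ≡ 2 + 2 * k + e
      reindex = solve-∀

    -- For i = 1+k+j all three binomials are proportional, so `x-step` and `y-step` reduce the claim
    -- to the polynomial `identity` in k, j, d. Comparing n = 2i+d with n = 2+2k+e forces e = 2j+d.
    pointwise-beyond : ∀ j d → 2 * (1 + k + j) + d ≡ n → Pointwise (2 * j + d) (1 + k + j)
    pointwise-beyond j d eq = +-cancelʳ-≡ (d * z) _ _ (begin-equality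
      5 * ((1 + k) * (2 + k)) * x + b * z + (1 + k) * (n ∸ i) * y + d * z
        ≡⟨ cong (λ m → 5 * ((1 + k) * (2 + k)) * x + b * z + (1 + k) * m * y + d * z) n∸i ⟩
      5 * ((1 + k) * (2 + k)) * x + b * z + (1 + k) * (i + d) * y + d * z
        ≡⟨ collect k (i + d) d b x y z ⟩
      5 * (1 + k) * ((2 + k) * x) + (i + d) * ((1 + k) * y) + b * z + d * z
        ≡⟨ cong (λ u → 5 * (1 + k) * u + (i + d) * ((1 + k) * y) + b * z + d * z) x-step ⟩
      5 * (1 + k) * (j * y) + (i + d) * ((1 + k) * y) + b * z + d * z
        ≡⟨ regroup k j (i + d) d b y z ⟩
      (5 * j + (i + d)) * ((1 + k) * y) + b * z + d * z
        ≡⟨ cong (λ u → (5 * j + (i + d)) * u + b * z + d * z) y-step ⟩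
      (5 * j + (i + d)) * ((1 + j) * z) + b * z + d * z
        ≡⟨ identity k j d z ⟩
      (3 + 5 * (2 * j + d) + k) * ((1 + j) * z) + d * d * z
        ≡⟨ cong₂ (λ u v → (3 + 5 * (2 * j + d) + k) * u + v) y-step (shifted-suc i d eq) ⟨
      (3 + 5 * (2 * j + d) + k) * ((1 + k) * y) + (shifted (suc i) + d * z)
        ≡⟨ expand k (3 + 5 * (2 * j + d) + k) y (shifted (suc i)) (d * z) ⟩
      (1 + k) * (3 + 5 * (2 * j + d) + k) * y + shifted (suc i) + d * z ∎)
      where
      i = 1 + k + j
      b = (2 + (2 * j + d)) * (1 + (2 * j + d))
      x = L i * (i C (2 + k))
      y = L i * (i C (1 + k))
      z = L i * (i C k)
      double : ∀ i d → i + (i + d) ≡ 2 * i + d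
      double = solve-∀
      n∸i : n ∸ i ≡ i + d
      n∸i = trans (cong (_∸ i) (sym (trans (double i d) eq))) (m+n∸m≡n i (i + d))
      slide : ∀ l a b → a * (l * b) ≡ l * (a * b)
      slide = solve-∀
      x-step : (2 + k) * x ≡ j * y
      x-step = trans (slide (L i) (2 + k) (i C (2 + k))) 
        (trans (cong (L i *_) (C-step (1 + k) j)) (sym (slide (L i) j (i C (1 + k)))))
      y-step : (1 + k) * y ≡ (1 + j) * z
      y-step = trans (slide (L i) (1 + k) (i C (1 + k))) (trans (cong (L i *_)
        (subst (λ m → (1 + k) * (m C (1 + k)) ≡ (1 + j) * (m C k)) (+-suc k j) (C-step k (1 + j))))
        (sym (slide (L i) (1 + j) (i C k))))
      collect : ∀ k m d b x y z →
        5 * ((1 + k) * (2 + k)) * x + b * z + (1 + k) * m * y + d * z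
        ≡ 5 * (1 + k) * ((2 + k) * x) + m * ((1 + k) * y) + b * z + d * z
      collect = solve-∀
      regroup : ∀ k j m d b y z →
        5 * (1 + k) * (j * y) + m * ((1 + k) * y) + b * z + d * z
        ≡ (5 * j + m) * ((1 + k) * y) + b * z + d * z
      regroup = solve-∀
      identity : ∀ k j d z →
        (5 * j + (1 + k + j + d)) * ((1 + j) * z)
        + (2 + (2 * j + d)) * (1 + (2 * j + d)) * z + d * z
        ≡ (3 + 5 * (2 * j + d) + k) * ((1 + j) * z) + d * d * z
      identity = solve-∀
      expand : ∀ k a y s t → a * ((1 + k) * y) + (s + t) ≡ (1 + k) * a * y + s + t
      expand = solve-∀

    pointwise : ∀ e i → 2 + 2 * k + e ≡ n → Pointwise e i
    pointwise e i eq with 2 * i ≤? n | <-cmp i k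
    ... | no 2i≰n  | _             = pointwise-above e i (≰⇒> 2i≰n)
    ... | yes _    | tri< i<k _ _  = pointwise-below e i i<k
    ... | yes _    | tri≈ _ refl _ = pointwise-at e eq
    ... | yes 2i≤n | tri> _ _ k<i with m≤n⇒∃[o]m+o≡n k<i
    ...   | j , refl = subst (λ m → Pointwise m i) (sym e≡) (pointwise-beyond j d d≡)
      where
      d = n ∸ 2 * (1 + k + j)
      d≡ : 2 * (1 + k + j) + d ≡ n
      d≡ = m+[n∸m]≡n 2i≤n
      reindex : ∀ k j d → 2 + 2 * k + (2 * j + d) ≡ 2 * (1 + k + j) + d
      reindex = solve-∀
      e≡ : e ≡ 2 * j + d
      e≡ = +-cancelˡ-≡ (2 + 2 * k) _ _ (trans eq (sym (trans (reindex k j d) d≡)))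

  JL-rec : ∀ e → 2 + 2 * k + e ≡ n → Rec k e (JL n k) (JL n (1 + k)) (JL n (2 + k))
  JL-rec e eq = mkRec (subst₂ _≡_
    (cong₂ (λ u v → a * u + b * v) (sym (JL≡∑ n (2 + k))) (sym (JL≡∑ n k)))
    (cong (f *_) (sym (JL≡∑ n (1 + k))))
    (+-cancelʳ-≡ (∑ shifted M) _ _ (begin-equality
      a * ∑ x M + b * ∑ z M + ∑ shifted M
        ≡⟨ cong (_+ ∑ shifted M) (cong₂ _+_ (∑-* a x M) (∑-* b z M)) ⟨
      ∑ (λ i → a * x i) M + ∑ (λ i → b * z i) M + ∑ shifted M
        ≡⟨ cong (_+ ∑ shifted M) (∑-+ (λ i → a * x i) (λ i → b * z i) M) ⟨
      ∑ (λ i → a * x i + b * z i) M + ∑ shifted M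
        ≡⟨ ∑-+ (λ i → a * x i + b * z i) shifted M ⟨
      ∑ (λ i → a * x i + b * z i + shifted i) M
        ≡⟨ ∑-cong (λ i → pointwise e i eq) M ⟩
      ∑ (λ i → f * y i + shifted (suc i)) M
        ≡⟨ ∑-+ (λ i → f * y i) (shifted ∘ suc) M ⟩
      ∑ (λ i → f * y i) M + ∑ (shifted ∘ suc) M
        ≡⟨ cong₂ _+_ (∑-* f y M) telescope ⟩
      f * ∑ y M + ∑ shifted M ∎)))
    where
    M = suc (n / 2)
    a = 5 * ((1 + k) * (2 + k))
    b = (2 + e) * (1 + e)
    f = (1 + k) * (3 + 5 * e + k)
    x = λ i → L i * (i C (2 + k))
    y = λ i → L i * (i C (1 + k))
    z = λ i → L i * (i C k)

    shifted-0 : shifted 0 ≡ 0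
    shifted-0 = trans (cong ((1 + k) * n *_) (*C-zero (L 0) {0} {1 + k} (s≤s z≤n))) (*-zeroʳ ((1 + k) * n))

    -- Both boundary terms vanish: C(0, k+1) = 0, and M = ⌊n/2⌋ + 1 lies beyond n/2.
    telescope : ∑ (shifted ∘ suc) M ≡ ∑ shifted M
    telescope = trans (cong (_+ ∑ (shifted ∘ suc) M) (sym shifted-0))
      (∑-last-zero shifted M (shifted-beyond M (n<2*suc[n/2] n)))

-- Vanishing and positivity.

JL-beyond : ∀ n k → n < 2 * k → JL n k ≡ 0
JL-beyond n k n<2k =
  cong (λ m → sum (map (λ j → lucasTerm n (k + j) * ((k + j) C k)) (upTo m)))
    (m≤n⇒m∸n≡0 (m<n*o⇒m/o<n {n} {k} {2} (subst (n <_) (*-comm 2 k) n<2k)))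

C-positive : ∀ n k → k ≤ n → 0 < n C k
C-positive n       zero    _         = ≤-reflexive (sym (nC0≡1 n))
C-positive (suc n) (suc k) (s≤s k≤n) = begin-strict
  0                    <⟨ C-positive n k k≤n ⟩
  n C k                ≤⟨ m≤m+n (n C k) (n C suc k) ⟩
  n C k + n C (suc k)  ≡⟨ nCk+nC[k+1]≡[n+1]C[k+1] n k ⟩
  suc n C suc k        ∎

-- As the division is exact, a zero quotient would make the positive number n C(n-i, i) zero.
lucasTerm-positive-at : ∀ i m → i ≤ 1 + m → 0 < lucasTerm (i + (1 + m)) i
lucasTerm-positive-at i m i≤1+m = n≢0⇒n>0 λ l≡0 → <⇒≢ (begin-strict
  0                                        <⟨ *-mono-< (≤-trans (s≤s z≤n) (m≤n+m (1 + m) i)) (C-positive (1 + m) i i≤1+m) ⟩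
  (i + (1 + m)) * ((1 + m) C i)            ≡⟨ lucasTerm-exact i m ⟨
  (1 + m) * lucasTerm (i + (1 + m)) i      ∎)
  (sym (trans (cong ((1 + m) *_) l≡0) (*-zeroʳ (1 + m))))

lucasTerm-positive : ∀ n i → 1 ≤ n → 2 * i ≤ n → 0 < lucasTerm n i
lucasTerm-positive n i 1≤n 2i≤n with m≤n⇒∃[o]m+o≡n 2i≤n
lucasTerm-positive _ zero    ()  2i≤n | zero , refl
lucasTerm-positive _ zero    1≤n 2i≤n | suc d , refl =
  lucasTerm-positive-at 0 d z≤n
lucasTerm-positive _ (suc i) 1≤n 2i≤n | d , refl =
  subst (λ n → 0 < lucasTerm n (suc i)) (reindex i d)
    (lucasTerm-positive-at (suc i) (i + d) (s≤s (m≤m+n i d)))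
  where
  reindex : ∀ i d → suc i + (1 + (i + d)) ≡ 2 * suc i + d
  reindex = solve-∀

JL-positive : ∀ n k → 1 ≤ n → 2 * k ≤ n → 0 < JL n k
JL-positive n k 1≤n 2k≤n = begin-strict
  0                                   <⟨ lucasTerm-positive n k 1≤n 2k≤n ⟩
  lucasTerm n k                       ≡⟨ *-identityʳ (lucasTerm n k) ⟨
  lucasTerm n k * 1                   ≡⟨ cong (lucasTerm n k *_) (nCn≡1 k) ⟨
  lucasTerm n k * (k C k)             ≤⟨ term≤∑ (λ i → lucasTerm n i * (i C k)) (s≤s k≤n/2) ⟩
  ∑ (λ i → lucasTerm n i * (i C k)) (suc (n / 2))  ≡⟨ JL≡∑ n k ⟨
  JL n k                              ∎
  where
  k≤n/2 : k ≤ n / 2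
  k≤n/2 = *≤⇒≤/ 2 k 2k≤n

-- Location of the mode.

ascends : ∀ (a : ℕ → ℕ) q → (∀ i → i < q → a i < a (suc i)) → ∀ {j} → j < q → a j < a q
ascends a (suc q) up {j} (s≤s j≤q) with m≤n⇒m<n∨m≡n j≤q
... | inj₁ j<q  = <-trans (ascends a q (λ i i<q → up i (m<n⇒m<1+n i<q)) j<q) (up q (n<1+n q))
... | inj₂ refl = up q (n<1+n q)

descends : ∀ (a : ℕ → ℕ) {q m} → (∀ i → q ≤ i → i < m → a (suc i) < a i) →
           ∀ j → q < j → j ≤ m → a j < a q
descends a down (suc j) (s≤s q≤j) j<m with m≤n⇒m<n∨m≡n q≤j
... | inj₁ q<j  = <-trans (down j q≤j j<m) (descends a down j q<j (<⇒≤ j<m))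
... | inj₂ refl = down j q≤j j<m

6*kstar≤2+n : ∀ n → 6 * kstar n ≤ 2 + n
6*kstar≤2+n n = begin
  6 * kstar n  ≡⟨ *-comm 6 (kstar n) ⟩
  kstar n * 6  ≤⟨ m/n*n≤m (n + 2) 6 ⟩
  n + 2        ≡⟨ +-comm n 2 ⟩
  2 + n        ∎

2+n<6*suc[kstar] : ∀ n → 2 + n < 6 * suc (kstar n)
2+n<6*suc[kstar] n = begin-strict
  2 + n                        ≡⟨ +-comm 2 n ⟩
  n + 2                        ≡⟨ m≡m%n+[m/n]*n (n + 2) 6 ⟩
  (n + 2) % 6 + kstar n * 6    <⟨ +-monoˡ-< (kstar n * 6) (m%n<n (n + 2) 6) ⟩
  6 + kstar n * 6              ≡⟨ *-comm (suc (kstar n)) 6 ⟩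
  6 * suc (kstar n)            ∎

-- Otherwise 3(n+1) ≤ 6 `kstar n` ≤ n+2.
kstar≤n/2 : ∀ n → 1 ≤ n → kstar n ≤ n / 2
kstar≤n/2 n 1≤n = *≤⇒≤/ 2 (kstar n) (≮⇒≥ λ n<2q → <⇒≱ (begin-strict
  2 + n            <⟨ +≡⇒≤ (2 * n) (solve (n ∷ [])) ⟩
  3 * suc n        ≤⟨ *-monoʳ-≤ 3 n<2q ⟩
  3 * (2 * kstar n)  ≡⟨ *-assoc 3 2 (kstar n) ⟨
  6 * kstar n      ∎) (6*kstar≤2+n n))

below-half : ∀ {n k} → k < n / 2 → ∃[ e ] 2 + 2 * k + e ≡ n
below-half {n} {k} k<n/2 = m≤n⇒∃[o]m+o≡n (begin
  2 + 2 * k    ≡⟨ *-suc 2 k ⟨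
  2 * suc k    ≤⟨ *-monoʳ-≤ 2 k<n/2 ⟩
  2 * (n / 2)  ≡⟨ *-comm 2 (n / 2) ⟩
  n / 2 * 2    ≤⟨ m/n*n≤m n 2 ⟩
  n            ∎)

theorem1p1 : (n : ℕ) → 1 ≤ n →
    (∀ k → 1 ≤ k → k < n / 2 → JL n (k ∸ 1) * JL n (k + 1) ≤ JL n k * JL n k)
    × Unimodal (JL n) (n / 2) (kstar n)
    × (∀ j → j ≤ n / 2 → Unimodal (JL n) (n / 2) j → j ≡ kstar n)
    × (∀ j → j ≤ n / 2 → j ≢ kstar n → JL n j < JL n (kstar n))
    × (∀ j → j < kstar n → JL n j < JL n (suc j))
theorem1p1 n 1≤n =
  log-concave , (q≤m , (λ i i<q → <⇒≤ (up i i<q)) , (λ i q≤i i<m → <⇒≤ (down i q≤i i<m))) ,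
  unique , maximal , up
  where
  open Ratios (JL n) n (JL-rec n) (JL-beyond n) (λ k → JL-positive n k 1≤n)

  q = kstar n
  q≤m = kstar≤n/2 n 1≤n

  log-concave : ∀ k → 1 ≤ k → k < n / 2 → JL n (k ∸ 1) * JL n (k + 1) ≤ JL n k * JL n k
  log-concave (suc k) _ k<m with below-half (<-trans (n<1+n k) k<m)
  ... | e , eq = subst (λ i → JL n k * JL n i ≤ JL n (suc k) * JL n (suc k)) (+-comm 1 (suc k))
    (logConcave k e eq)

  up : ∀ i → i < q → JL n i < JL n (suc i)
  -- From i < q follows 6i+6 ≤ n+2; writing n = 6i+4+o gives e = 2+4i+o, the range of `rise`.
  up i i<q with m≤n⇒∃[o]m+o≡n {4 + 6 * i} {n} (+-cancelˡ-≤ 2 _ _ (begin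
    6 + 6 * i  ≡⟨ *-suc 6 i ⟨
    6 * suc i  ≤⟨ *-monoʳ-≤ 6 i<q ⟩
    6 * q      ≤⟨ 6*kstar≤2+n n ⟩
    2 + n      ∎))
  ... | o , eq = rise i (2 + 4 * i + o) (m≤m+n (2 + 4 * i) o) (trans (reindex i o) eq)
    where
    reindex : ∀ i o → 2 + 2 * i + (2 + 4 * i + o) ≡ 4 + 6 * i + o
    reindex = solve-∀

  down : ∀ i → q ≤ i → i < n / 2 → JL n (suc i) < JL n i
  down i q≤i i<m with below-half i<m
  -- From q ≤ i follows n+2 < 6i+6, which for n = 2+2i+e reads e ≤ 1+4i.
  ... | e , eq = fall i e (+-cancelˡ-≤ (5 + 2 * i) _ _ (begin
    5 + 2 * i + e              ≡⟨ cong (3 +_) eq ⟩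
    3 + n                      ≤⟨ 2+n<6*suc[kstar] n ⟩
    6 * suc q                  ≤⟨ *-monoʳ-≤ 6 (s≤s q≤i) ⟩
    6 * suc i                  ≡⟨ solve (i ∷ []) ⟩
    5 + 2 * i + (1 + 4 * i)    ∎)) eq

  -- A mode before q contradicts the strict rise at j, one after q the strict fall at q.
  unique : ∀ j → j ≤ n / 2 → Unimodal (JL n) (n / 2) j → j ≡ q
  unique j j≤m (_ , before , after) with <-cmp j q
  ... | tri< j<q _ _ = contradiction (after j ≤-refl (<-≤-trans j<q q≤m)) (<⇒≱ (up j j<q))
  ... | tri≈ _ j≡q _ = j≡q
  ... | tri> _ _ q<j = contradiction (before q q<j) (<⇒≱ (down q ≤-refl (<-≤-trans q<j j≤m)))

  maximal : ∀ j → j ≤ n / 2 → j ≢ q → JL n j < JL n q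
  maximal j j≤m j≢q with <-cmp j q
  ... | tri< j<q _ _ = ascends (JL n) q up j<q
  ... | tri≈ _ j≡q _ = contradiction j≡q j≢q
  ... | tri> _ _ q<j = descends (JL n) down j q<j j≤m
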